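{- Let $\mathbb I=(0,1]\cap\mathbb Q$, canonically arranged as below. Then $\sigma(\mathbb I)=(\Phi(n))_{n\in\mathbb N}$, where $\Phi(n)=\sum_{i=1}^n\varphi(i)$ and $\varphi$ is Euler's totient function; moreover $\sigma(\mathbb I)\approx_\mathcal F\alpha^2$, and more precisely $$\tfrac{3}{10}\,\alpha^2<_\mathcal F\sigma(\mathbb I)<_\mathcal F\frac{\alpha^2-\alpha}{2}.$$
   Context: $\mathbb N=\{1,2,\dots\}$. Each $x\in\mathbb I$ is represented uniquely as the pair $(k,m)\in\mathbb N\times\mathbb N$ with $x=k/m$, $\gcd(k,m)=1$, $k\le m$. $\mathbb N\times\mathbb N$ is arranged with $n$-th component $\{(i,j):\max\{i,j\}=n\}$, and $\mathbb I$ inherits the arrangement, so its $n$-th component is $\mathbb I_n=\{(k,n): \gcd(k,n)=1,\ k\le n\}$. The size sequence is $\sigma(\mathbb I)=(\sigma_n(\mathbb I))_n$, $\sigma_n(\mathbb I)=|\mathbb I_1|+\dots+|\mathbb I_n|$. $\alpha=(n)_n$; operations on sequences are componentwise, rational constants are identified with constant sequences. $(a_n)<_\mathcal F(b_n)$ iff $a_n<b_n$ for all sufficiently large $n$; $(a_n)\ge_\mathcal F(b_n)$ analogously; $(a_n)\approx_\mathcal F(b_n)$ iff some $k\in\mathbb N$ has $k(a_n)\ge_\mathcal F(b_n)$ and some $k$ has $k(b_n)\ge_\mathcal F(a_n)$. -}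

module Defs where

open import Data.Nat.Base as ℕ using (ℕ; zero; suc; NonZero; _⊔_)
import Data.Nat.Properties as ℕ
open import Data.Nat.GCD using (gcd)
open import Data.Nat.Coprimality using (Coprime; coprime⇒gcd≡1; gcd≡1⇒coprime)
open import Data.Integer.Base as ℤ using (+_; -[1+_]; +[1+_])
import Data.Integer.Properties as ℤ
open import Data.Rational.Base as ℚ using (ℚ; mkℚ; ↥_; ↧ₙ_; 0ℚ; 1ℚ)
import Data.Rational.Properties as ℚ
open import Data.Fin.Base using (Fin; zero; suc; toℕ; fromℕ<)
open import Data.Fin.Properties using (toℕ<n; toℕ-fromℕ<; fromℕ<-toℕ)
open import Data.List.Base using (length; filter; applyUpTo)
open import Data.Product.Base using (Σ-syntax; ∃-syntax; _×_; _,_; proj₁; proj₂)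
open import Function.Base using (_∘_)
open import Function.Bundles using (_↔_; mk↔ₛ′; Inverse)
open import Function.Construct.Composition using (_↔-∘_)
open import Relation.Nullary.Decidable.Core using (yes; no; recompute)
open import Relation.Nullary.Negation.Core using (contradiction)
open import Relation.Unary using (Decidable; Irrelevant)
open import Relation.Binary.PropositionalEquality
  using (_≡_; refl; sym; trans; cong; subst)

-- The index set is {1, 2, …}.
Seq : Set → Set
Seq A = (n : ℕ) → .{{NonZero n}} → A

infix 4 _≗ₛ_

_≗ₛ_ : {A : Set} → Seq A → Seq A → Set
a ≗ₛ b = ∀ n .{{_ : NonZero n}} → a n ≡ b n

partialSum : Seq ℕ → ℕ → ℕ
partialSum f zero    = 0
partialSum f (suc n) = partialSum f n ℕ.+ f (suc n)

const : ℚ → Seq ℚ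
const q n = q

⌜_⌝ : Seq ℕ → Seq ℚ
⌜ a ⌝ n = + a n ℚ./ 1

α : Seq ℚ
α n = + n ℚ./ 1

infixl 6 _-ₛ_
infixl 7 _*ₛ_ _÷ₛ_

_-ₛ_ _*ₛ_ : Seq ℚ → Seq ℚ → Seq ℚ
(a -ₛ b) n = a n ℚ.- b n
(a *ₛ b) n = a n ℚ.* b n

_÷ₛ_ : Seq ℚ → (q : ℚ) → .{{ℚ.NonZero q}} → Seq ℚ
(a ÷ₛ q) n = a n ℚ.÷ q

infix 4 _<𝓕_ _≥𝓕_ _≈𝓕_

_<𝓕_ _≥𝓕_ _≈𝓕_ : Seq ℚ → Seq ℚ → Set
a <𝓕 b = ∃[ N ] (∀ n .{{_ : NonZero n}} → N ℕ.≤ n → a n ℚ.< b n)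
a ≥𝓕 b = ∃[ N ] (∀ n .{{_ : NonZero n}} → N ℕ.≤ n → a n ℚ.≥ b n)
a ≈𝓕 b = (∃[ k ] NonZero k × const (+ k ℚ./ 1) *ₛ a ≥𝓕 b)
       × (∃[ k ] NonZero k × const (+ k ℚ./ 1) *ₛ b ≥𝓕 a)

Finite : Set → Set
Finite A = ∃[ c ] (A ↔ Fin c)

∣_∣ : {A : Set} → Finite A → ℕ
∣ c , _ ∣ = c

-- An arrangement splits a set into finite components A₁, A₂, …;
-- it is given by the map sending x to the n with x ∈ Aₙ.
record Arranged : Set₁ where
  field
    Carrier : Set
    index   : Carrier → ℕ
    index≢0 : ∀ x → NonZero (index x)

  Component : ℕ → Set
  Component n = Σ[ x ∈ Carrier ] index x ≡ n

  field
    finite  : ∀ n .{{_ : NonZero n}} → Finite (Component n)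

σ : Arranged → Seq ℕ
σ A n = partialSum (λ i → ∣ finite i ∣) n
  where open Arranged A

finite-Σ-Fin : ∀ n {P : Fin n → Set} → Decidable P → Irrelevant P →
               Finite (Σ[ k ∈ Fin n ] P k)
finite-Σ-Fin zero    P? irr = 0 , mk↔ₛ′ (λ ()) (λ ()) (λ ()) (λ ())
finite-Σ-Fin (suc n) {P} P? irr
  with finite-Σ-Fin n {P ∘ suc} (P? ∘ suc) irr | P? zero
... | c , e | yes p = suc c , mk↔ₛ′ to from to∘from from∘to
  where
  to : Σ[ k ∈ Fin (suc n) ] P k → Fin (suc c)
  to (zero  , _) = zero
  to (suc k , q) = suc (Inverse.to e (k , q))

  from : Fin (suc c) → Σ[ k ∈ Fin (suc n) ] P k
  from zero    = zero , p
  from (suc j) = suc (proj₁ (Inverse.from e j)) , proj₂ (Inverse.from e j)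

  to∘from : ∀ j → to (from j) ≡ j
  to∘from zero    = refl
  to∘from (suc j) = cong suc (Inverse.strictlyInverseˡ e j)

  from∘to : ∀ x → from (to x) ≡ x
  from∘to (zero  , q) = cong (zero ,_) (irr p q)
  from∘to (suc k , q) =
    cong (λ (k , q) → suc k , q) (Inverse.strictlyInverseʳ e (k , q))
... | c , e | no ¬p = c , mk↔ₛ′ to from to∘from from∘to
  where
  to : Σ[ k ∈ Fin (suc n) ] P k → Fin c
  to (zero  , q) = contradiction q ¬p
  to (suc k , q) = Inverse.to e (k , q)

  from : Fin c → Σ[ k ∈ Fin (suc n) ] P k
  from j = suc (proj₁ (Inverse.from e j)) , proj₂ (Inverse.from e j)

  to∘from : ∀ j → to (from j) ≡ j
  to∘from j = Inverse.strictlyInverseˡ e j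

  from∘to : ∀ x → from (to x) ≡ x
  from∘to (zero  , q) = contradiction q ¬p
  from∘to (suc k , q) =
    cong (λ (k , q) → suc k , q) (Inverse.strictlyInverseʳ e (k , q))

-- The component of ℕ × ℕ containing (i , j).
max-index : ℕ × ℕ → ℕ
max-index (i , j) = i ⊔ j

∈𝕀 : ℚ → Set
∈𝕀 x = 0ℚ ℚ.< x × x ℚ.≤ 1ℚ

-- Values of type ℚ are in lowest terms, so this is the unique coprime
-- pair (k , m) with x = k / m.
rep : Σ[ x ∈ ℚ ] ∈𝕀 x → ℕ × ℕ
rep (x , _) = ℤ.∣ ↥ x ∣ , ↧ₙ x

module 𝕀-Finite where

  Comp : ℕ → Set
  Comp n = Σ[ x ∈ (Σ[ x ∈ ℚ ] ∈𝕀 x) ] max-index (rep x) ≡ n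

  ∈𝕀-irrelevant : Irrelevant ∈𝕀
  ∈𝕀-irrelevant (p , q) (p′ , q′)
    rewrite ℚ.<-irrelevant p p′ | ℚ.≤-irrelevant q q′ = refl

  Comp-≡ : ∀ {n} {a b : Comp n} → proj₁ (proj₁ a) ≡ proj₁ (proj₁ b) → a ≡ b
  Comp-≡ {a = (x , p) , e} {(.x , p′) , e′} refl
    rewrite ∈𝕀-irrelevant p p′ | ℕ.≡-irrelevant e e′ = refl

  0<⇒0<↥ : ∀ {x} → 0ℚ ℚ.< x → ℤ.0ℤ ℤ.< ↥ x
  0<⇒0<↥ {x} p = subst (ℤ.0ℤ ℤ.<_) (ℤ.*-identityʳ (↥ x)) (ℚ.drop-*<* p)

  ≤1⇒k≤m : ∀ {k m} .{c : Coprime (suc k) (suc m)} →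
           mkℚ +[1+ k ] m c ℚ.≤ 1ℚ → suc k ℕ.≤ suc m
  ≤1⇒k≤m {k} {m} p with ℚ.drop-*≤* p
  ... | ℤ.+≤+ q rewrite ℕ.*-identityʳ k | ℕ.+-identityʳ m = q

  k≤m⇒≤1 : ∀ {k m} .{c : Coprime (suc k) (suc m)} →
           suc k ℕ.≤ suc m → mkℚ +[1+ k ] m c ℚ.≤ 1ℚ
  k≤m⇒≤1 {k} {m} q = ℚ.*≤* (ℤ.+≤+ q′)
    where
    q′ : suc (k ℕ.* 1) ℕ.≤ suc (m ℕ.+ 0)
    q′ rewrite ℕ.*-identityʳ k | ℕ.+-identityʳ m = q

  Numerator : ℕ → Set
  Numerator n = Σ[ k ∈ Fin n ] gcd (suc (toℕ k)) n ≡ 1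

  gcd≡1 : ∀ {k m} → .(Coprime k m) → gcd k m ≡ 1
  gcd≡1 {k} {m} c = recompute (gcd k m ℕ.≟ 1) (coprime⇒gcd≡1 c)

  Numerator-≡ : ∀ {n} {a b : Numerator n} → proj₁ a ≡ proj₁ b → a ≡ b
  Numerator-≡ {a = k , e} {.k , e′} refl = cong (k ,_) (ℕ.≡-irrelevant e e′)

  to : ∀ n → Comp n → Numerator n
  to n ((mkℚ (+ zero) m c , 0<x , x≤1) , e) with 0<⇒0<↥ 0<x
  ... | ℤ.+<+ ()
  to n ((mkℚ -[1+ k ] m c , 0<x , x≤1) , e) with 0<⇒0<↥ 0<x
  ... | ()
  to n ((mkℚ +[1+ k ] m c , 0<x , x≤1) , e)
    with refl ← trans (sym (ℕ.m≤n⇒m⊔n≡n (≤1⇒k≤m x≤1))) e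
    = fromℕ< (≤1⇒k≤m x≤1)
    , subst (λ k → gcd (suc k) (suc m) ≡ 1)
            (sym (toℕ-fromℕ< (≤1⇒k≤m x≤1))) (gcd≡1 c)

  from : ∀ n → Numerator n → Comp n
  from (suc m) (k , e) =
      ( mkℚ +[1+ toℕ k ] m (gcd≡1⇒coprime e)
      , ℚ.positive⁻¹ (mkℚ +[1+ toℕ k ] m (gcd≡1⇒coprime e))
      , k≤m⇒≤1 (toℕ<n k))
    , ℕ.m≤n⇒m⊔n≡n (toℕ<n k)

  to∘from : ∀ n x → to n (from n x) ≡ x
  to∘from (suc m) (k , e)
    with refl ← trans (sym (ℕ.m≤n⇒m⊔n≡n (≤1⇒k≤m (k≤m⇒≤1 {c = gcd≡1⇒coprime e} (toℕ<n k))))) (ℕ.m≤n⇒m⊔n≡n (toℕ<n k))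
    = Numerator-≡ (fromℕ<-toℕ k _)

  mkℚ-cong : ∀ {k k′ m} .{c : Coprime (suc k) (suc m)} .{c′ : Coprime (suc k′) (suc m)} →
             k ≡ k′ → mkℚ +[1+ k ] m c ≡ mkℚ +[1+ k′ ] m c′
  mkℚ-cong refl = refl

  from∘to : ∀ n x → from n (to n x) ≡ x
  from∘to n ((mkℚ (+ zero) m c , 0<x , x≤1) , e) with 0<⇒0<↥ 0<x
  ... | ℤ.+<+ ()
  from∘to n ((mkℚ -[1+ k ] m c , 0<x , x≤1) , e) with 0<⇒0<↥ 0<x
  ... | ()
  from∘to n ((mkℚ +[1+ k ] m c , 0<x , x≤1) , e)
    with refl ← trans (sym (ℕ.m≤n⇒m⊔n≡n (≤1⇒k≤m x≤1))) e
    = Comp-≡ (mkℚ-cong (toℕ-fromℕ< (≤1⇒k≤m x≤1)))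

  Comp-finite : ∀ n → Finite (Comp n)
  Comp-finite n =
    let c , numerators = finite-Σ-Fin n (λ k → gcd (suc (toℕ k)) n ℕ.≟ 1) ℕ.≡-irrelevant
    in  c , numerators ↔-∘ mk↔ₛ′ (to n) (from n) (to∘from n) (from∘to n)

𝕀 : Arranged
𝕀 = record
  { Carrier = Σ[ x ∈ ℚ ] ∈𝕀 x
  ; index   = max-index ∘ rep
  ; index≢0 = λ (x , _) → ℕ.>-nonZero (ℕ.<-≤-trans ℕ.z<s (ℕ.m≤n⊔m ℤ.∣ ↥ x ∣ (↧ₙ x)))
  ; finite  = λ n → 𝕀-Finite.Comp-finite n
  }

φ : Seq ℕ
φ n = length (filter (λ k → gcd k n ℕ.≟ 1) (applyUpTo suc n))

Φ : Seq ℕ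
Φ n = partialSum φ n

{-# OPTIONS --safe #-}
module Submission where

open import Defs
open import Data.Nat.Base
open import Data.Nat.Properties
open import Data.Nat.Divisibility
open import Data.Nat.DivMod
open import Data.Nat.GCD using (gcd; gcd[m,n]∣m; gcd[m,n]∣n; gcd-greatest; gcd[m,n]≤n)
open import Data.Nat.LCM using (lcm-least)
open import Data.Nat.Tactic.RingSolver using (solve-∀)
import Data.Integer.Base as ℤ
import Data.Integer.Properties as ℤ
open import Data.Rational.Base as ℚ using (ℚ)
import Data.Rational.Properties as ℚ
open import Data.Rational.Unnormalised.Base as ℚᵘ using (mkℚᵘ)
import Data.Rational.Unnormalised.Properties as ℚᵘ
open import Data.Bool.Base using (if_then_else_)
open import Data.Fin.Base using (Fin; zero; suc; toℕ)
open import Data.List.Base using ([]; _∷_; _∷ʳ_; _++_; length; filter; applyUpTo)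
open import Data.List.Properties using (applyUpTo-∷ʳ; filter-++; length-++)
open import Data.Product.Base using (∃-syntax; _×_; _,_)
open import Data.Sum.Base using (inj₁; inj₂)
open import Data.Unit.Base using (tt)
open import Function.Base using (_∘_)
open import Relation.Nullary.Decidable.Core using (Dec; yes; no; does)
open import Relation.Nullary.Negation.Core using (¬_; contradiction)
open import Relation.Unary using (Decidable; Irrelevant)
open import Relation.Binary.PropositionalEquality
  using (_≡_; _≢_; refl; sym; trans; cong; cong₂; subst; subst₂; module ≡-Reasoning)

-- For the lower bound, sieve the pairs k ≤ m ≤ n by g = gcd (k , m).  The pairs
-- with g coprime to 6 number about n² / 3, and each of them has g = 1 or g = d
-- for some d in 5, 7, 11, 13, …, the numbers ±1 modulo 6.  For each such d, the
-- pairs with g = d correspond to coprime pairs up to q = n / d, which are at most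
-- as many as the pairs up to q with gcd coprime to 6, about q² / 3.
-- Since 1/5² + 1/7² + 1/11² + 1/13² + … < 98/1000, there remain at least
-- (1 - 98/1000) n² / 3 - O(n) > (3/10) n² coprime pairs.  The upper bound follows
-- from φ n ≤ n - 1 for n ≥ 2, which is strict for n = 4 and n = 6.

-- Indicators and finite sums.

⟦_⟧ : {P : Set} → Dec P → ℕ
⟦ P? ⟧ = if does P? then 1 else 0

⟦⟧≤1 : {P : Set} (P? : Dec P) → ⟦ P? ⟧ ≤ 1
⟦⟧≤1 (yes _) = ≤-refl
⟦⟧≤1 (no _)  = z≤n

⟦⟧-yes : {P : Set} (P? : Dec P) → P → ⟦ P? ⟧ ≡ 1
⟦⟧-yes (yes _) p = refl
⟦⟧-yes (no ¬p) p = contradiction p ¬p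

⟦⟧-no : {P : Set} (P? : Dec P) → ¬ P → ⟦ P? ⟧ ≡ 0
⟦⟧-no (yes p) ¬p = contradiction p ¬p
⟦⟧-no (no _)  ¬p = refl

partialSum-mono : ∀ {f g : Seq ℕ} n → (∀ i .{{_ : NonZero i}} → i ≤ n → f i ≤ g i) →
                  partialSum f n ≤ partialSum g n
partialSum-mono zero    f≤g = z≤n
partialSum-mono (suc n) f≤g =
  +-mono-≤ (partialSum-mono n (λ i i≤n → f≤g i (m≤n⇒m≤1+n i≤n))) (f≤g (suc n) ≤-refl)

partialSum-cong : ∀ {f g : Seq ℕ} n → (∀ i .{{_ : NonZero i}} → f i ≡ g i) →
                  partialSum f n ≡ partialSum g n
partialSum-cong zero    f≡g = refl
partialSum-cong (suc n) f≡g = cong₂ _+_ (partialSum-cong n f≡g) (f≡g (suc n))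

partialSum-+ : ∀ (f g : Seq ℕ) n →
               partialSum (λ i → f i + g i) n ≡ partialSum f n + partialSum g n
partialSum-+ f g zero    = refl
partialSum-+ f g (suc n) =
  trans (cong (_+ (f (suc n) + g (suc n))) (partialSum-+ f g n))
        (interchange (partialSum f n) (partialSum g n) (f (suc n)) (g (suc n)))
  where
  interchange : ∀ a b c d → a + b + (c + d) ≡ a + c + (b + d)
  interchange = solve-∀

partialSum-*ˡ : ∀ c (f : Seq ℕ) n → partialSum (λ i → c * f i) n ≡ c * partialSum f n
partialSum-*ˡ c f zero    = sym (*-zeroʳ c)
partialSum-*ˡ c f (suc n) =
  trans (cong (_+ c * f (suc n)) (partialSum-*ˡ c f n)) (sym (*-distribˡ-+ c _ _))

partialSum-const : ∀ c n → partialSum (λ _ → c) n ≡ n * c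
partialSum-const c zero    = refl
partialSum-const c (suc n) = trans (cong (_+ c) (partialSum-const c n)) (+-comm (n * c) c)

partialSum-0 : ∀ n → partialSum (λ _ → 0) n ≡ 0
partialSum-0 n = trans (partialSum-const 0 n) (*-zeroʳ n)

partialSum-swap : ∀ (f : ∀ i → .{{NonZero i}} → Seq ℕ) n m →
                  partialSum (λ i → partialSum (λ j → f i j) m) n ≡
                  partialSum (λ j → partialSum (λ i → f i j) n) m
partialSum-swap f zero    m = sym (partialSum-0 m)
partialSum-swap f (suc n) m =
  trans (cong (_+ partialSum (λ j → f (suc n) j) m) (partialSum-swap f n m))
        (sym (partialSum-+ (λ j → partialSum (λ i → f i j) n) (λ j → f (suc n) j) m))

-- The size sequence as a sum of totients.

length-filter-applyUpTo : ∀ {P : ℕ → Set} (P? : Decidable P) n →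
  length (filter P? (applyUpTo suc n)) ≡ partialSum (λ k → ⟦ P? k ⟧) n
length-filter-applyUpTo P? zero    = refl
length-filter-applyUpTo P? (suc n) = begin
  length (filter P? (applyUpTo suc (suc n)))                   ≡⟨ cong (length ∘ filter P?) (applyUpTo-∷ʳ suc n) ⟨
  length (filter P? (applyUpTo suc n ∷ʳ suc n))                ≡⟨ cong length (filter-++ P? (applyUpTo suc n) _) ⟩
  length (filter P? (applyUpTo suc n) ++ filter P? (suc n ∷ [])) ≡⟨ length-++ (filter P? (applyUpTo suc n)) ⟩
  length (filter P? (applyUpTo suc n)) + length (filter P? (suc n ∷ []))
    ≡⟨ cong₂ _+_ (length-filter-applyUpTo P? n) (singleton (suc n)) ⟩
  partialSum (λ k → ⟦ P? k ⟧) (suc n)                          ∎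
  where
  open ≡-Reasoning
  singleton : ∀ k → length (filter P? (k ∷ [])) ≡ ⟦ P? k ⟧
  singleton k with P? k
  ... | yes _ = refl
  ... | no _  = refl

-- The map f is arbitrary because the induction passes to `f ∘ suc` on the tail of `Fin (suc n)`.
∣finite-Σ-Fin∣ : ∀ n (f : ℕ → ℕ) {Q : ℕ → Set} (Q? : Decidable Q)
  (irr : Irrelevant (λ (k : Fin n) → Q (f (toℕ k)))) →
  ∣ finite-Σ-Fin n (λ k → Q? (f (toℕ k))) irr ∣ ≡ length (filter Q? (applyUpTo f n))
∣finite-Σ-Fin∣ zero    f Q? irr = refl
∣finite-Σ-Fin∣ (suc n) f {Q} Q? irr
  with finite-Σ-Fin n {λ k → Q (f (suc (toℕ k)))} (λ k → Q? (f (suc (toℕ k)))) irr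
     | ∣finite-Σ-Fin∣ n (f ∘ suc) Q? irr | Q? (f 0)
... | c , e | eq | yes p = cong suc eq
... | c , e | eq | no ¬p = eq

-- The cardinality stored in `Comp-finite` reduces to the one computed by `finite-Σ-Fin`, so only
-- the counts of coprime numerators are compared.
σ𝕀≗Φ : σ 𝕀 ≗ₛ Φ
σ𝕀≗Φ n = partialSum-cong n
  (λ i → ∣finite-Σ-Fin∣ i suc (λ k → gcd k i ≟ 1) ≡-irrelevant)

-- Sums over pairs, weighted by a function of the gcd.

δ : ℕ → ℕ → ℕ
δ d g = ⟦ g ≟ d ⟧

[_∣_] : ℕ → ℕ → ℕ
[ d ∣ g ] = ⟦ d ∣? g ⟧

-- This is additive and monotone in the weight h, so an inequality between indicators of a single
-- number g becomes an inequality between counts of pairs.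
gcdSum : (ℕ → ℕ) → ℕ → ℕ
gcdSum h n = partialSum (λ m → partialSum (λ k → h (gcd k m)) m) n

φ≡ : ∀ n .{{_ : NonZero n}} → φ n ≡ partialSum (λ k → δ 1 (gcd k n)) n
φ≡ n = length-filter-applyUpTo (λ k → gcd k n ≟ 1) n

Φ≡gcdSum : ∀ n .{{_ : NonZero n}} → Φ n ≡ gcdSum (δ 1) n
Φ≡gcdSum n = partialSum-cong n φ≡

-- Every gcd that occurs is at most n. The restriction matters because `sieve` compares its weights
-- only on a bounded range.
gcdSum-mono : ∀ {f g} n → (∀ d → d ≤ n → f d ≤ g d) → gcdSum f n ≤ gcdSum g n
gcdSum-mono n f≤g = partialSum-mono n λ m m≤n → partialSum-mono m λ k k≤m →
  f≤g (gcd k m) (≤-trans (gcd[m,n]≤n k m) m≤n)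

gcdSum-+ : ∀ f g n → gcdSum (λ d → f d + g d) n ≡ gcdSum f n + gcdSum g n
gcdSum-+ f g n = trans
  (partialSum-cong n λ m → partialSum-+ (λ k → f (gcd k m)) (λ k → g (gcd k m)) m)
  (partialSum-+ (λ m → partialSum (λ k → f (gcd k m)) m) (λ m → partialSum (λ k → g (gcd k m)) m) n)

gcdSum-∑ : ∀ (f : ∀ j → .{{NonZero j}} → ℕ → ℕ) n J →
           gcdSum (λ d → partialSum (λ j → f j d) J) n ≡ partialSum (λ j → gcdSum (f j) n) J
gcdSum-∑ f n J = trans
  (partialSum-cong n λ m → partialSum-swap (λ k j → f j (gcd k m)) m J)
  (partialSum-swap (λ m j → partialSum (λ k → f j (gcd k m)) m) n J)

-- Pairs whose gcd is divisible by d.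

△ : ℕ → ℕ
△ = partialSum (λ n → n)

suc-/-∣ : ∀ n d .{{_ : NonZero d}} → d ∣ suc n → suc n / d ≡ n / d + 1
suc-/-∣ n d@(suc d-1) (divides (suc c) eq) = begin
  suc n / d               ≡⟨ /-congˡ eq ⟩
  suc c * d / d           ≡⟨ m*n/n≡m (suc c) d ⟩
  suc c                   ≡⟨ +-comm 1 c ⟩
  -- Cancelling the successor in `eq` leaves n = d-1 + c * d, whose quotient by d is c.
  c + 1                   ≡⟨ cong₂ (λ x y → x + y + 1) (m<n⇒m/n≡0 {d-1} {d} ≤-refl) (m*n/n≡m c d) ⟨
  d-1 / d + c * d / d + 1 ≡⟨ cong (_+ 1) (+-distrib-/-∣ʳ d-1 (n∣m*n c)) ⟨
  (d-1 + c * d) / d + 1   ≡⟨ cong (_+ 1) (/-congˡ (suc-injective eq)) ⟨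
  n / d + 1               ∎
  where open ≡-Reasoning

-- Off the multiples of d, the remainder of n plus one is still below d: if it reached d, then d
-- would divide `suc n`.
suc-/ : ∀ n d .{{_ : NonZero d}} → suc n / d ≡ n / d + [ d ∣ suc n ]
suc-/ n d with d ∣? suc n
... | yes d∣ = suc-/-∣ n d d∣
... | no d∤ = begin
  suc n / d                                  ≡⟨ /-congˡ (cong suc (m≡m%n+[m/n]*n n d)) ⟩
  (suc (n % d) + n / d * d) / d              ≡⟨ +-distrib-/-∣ʳ (suc (n % d)) (n∣m*n (n / d)) ⟩
  suc (n % d) / d + n / d * d / d            ≡⟨ cong₂ _+_ (m<n⇒m/n≡0 (≤∧≢⇒< (m%n<n n d) 1+r≢d)) (m*n/n≡m (n / d) d) ⟩
  n / d                                      ≡⟨ +-identityʳ (n / d) ⟨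
  n / d + 0                                  ∎
  where
  open ≡-Reasoning
  1+r≢d : suc (n % d) ≢ d
  1+r≢d eq = d∤ (subst (d ∣_) (sym (cong suc (m≡m%n+[m/n]*n n d)))
    (∣m∣n⇒∣m+n (subst (d ∣_) (sym eq) ∣-refl) (n∣m*n (n / d))))

count-multiples : ∀ d n .{{_ : NonZero d}} → partialSum (λ k → [ d ∣ k ]) n ≡ n / d
count-multiples d zero    = sym (0/n≡0 d)
count-multiples d (suc n) =
  trans (cong (_+ [ d ∣ suc n ]) (count-multiples d n)) (sym (suc-/ n d))

[∣gcd] : ∀ d k m → [ d ∣ gcd k m ] ≡ [ d ∣ k ] * [ d ∣ m ]
[∣gcd] d k m with d ∣? k | d ∣? m
... | yes d∣k | yes d∣m = ⟦⟧-yes (d ∣? gcd k m) (gcd-greatest d∣k d∣m)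
... | yes d∣k | no d∤m  = ⟦⟧-no (d ∣? gcd k m) (λ d∣g → d∤m (∣-trans d∣g (gcd[m,n]∣n k m)))
... | no d∤k  | _       = ⟦⟧-no (d ∣? gcd k m) (λ d∣g → d∤k (∣-trans d∣g (gcd[m,n]∣m k m)))

△-/ : ∀ n d .{{_ : NonZero d}} → △ (suc n / d) ≡ △ (n / d) + [ d ∣ suc n ] * (suc n / d)
△-/ n d with d ∣? suc n | suc-/ n d
... | yes _ | eq rewrite eq | +-comm (n / d) 1 = cong (△ (n / d) +_) (sym (*-identityˡ _))
... | no _  | eq rewrite eq | +-identityʳ (n / d) = sym (+-identityʳ _)

-- Such pairs are d times an arbitrary pair up to n / d. Row by row: if d divides m, the multiples
-- of d up to m number m / d; otherwise row m contributes nothing.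
gcdSum-∣ : ∀ d n .{{_ : NonZero d}} → gcdSum [ d ∣_] n ≡ △ (n / d)
gcdSum-∣ d zero    = cong △ (sym (0/n≡0 d))
gcdSum-∣ d (suc n) = trans (cong₂ _+_ (gcdSum-∣ d n) row) (sym (△-/ n d))
  where
  open ≡-Reasoning
  row : partialSum (λ k → [ d ∣ gcd k (suc n) ]) (suc n) ≡ [ d ∣ suc n ] * (suc n / d)
  row = begin
    partialSum (λ k → [ d ∣ gcd k (suc n) ]) (suc n)
      ≡⟨ partialSum-cong (suc n) (λ k → trans ([∣gcd] d k (suc n)) (*-comm [ d ∣ k ] _)) ⟩
    partialSum (λ k → [ d ∣ suc n ] * [ d ∣ k ]) (suc n)
      ≡⟨ partialSum-*ˡ [ d ∣ suc n ] (λ k → [ d ∣ k ]) (suc n) ⟩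
    [ d ∣ suc n ] * partialSum (λ k → [ d ∣ k ]) (suc n)
      ≡⟨ cong ([ d ∣ suc n ] *_) (count-multiples d (suc n)) ⟩
    [ d ∣ suc n ] * (suc n / d) ∎

-- Inclusion-exclusion over 2 and 3.

2*△ : ∀ n → 2 * △ n ≡ n * suc n
2*△ zero    = refl
2*△ (suc n) = trans (*-distribˡ-+ 2 (△ n) (suc n)) (trans (cong (_+ 2 * suc n) (2*△ n)) (step n))
  where
  step : ∀ n → n * suc n + 2 * suc n ≡ suc n * suc (suc n)
  step = solve-∀

[r+a*m*d]/d : ∀ d .{{_ : NonZero d}} r a m → (r + a * (m * d)) / d ≡ r / d + a * m
[r+a*m*d]/d d r a m = begin
  (r + a * (m * d)) / d     ≡⟨ /-congˡ (cong (r +_) (sym (*-assoc a m d))) ⟩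
  (r + a * m * d) / d       ≡⟨ +-distrib-/-∣ʳ r (n∣m*n (a * m)) ⟩
  r / d + a * m * d / d     ≡⟨ cong (r / d +_) (m*n/n≡m (a * m) d) ⟩
  r / d + a * m             ∎
  where open ≡-Reasoning

-- By inclusion-exclusion, △ n - △ (n / 2) - △ (n / 3) + △ (n / 6) is the number of
-- pairs k ≤ m ≤ n with gcd coprime to 6; it is n² / 3 + u / 6.
△-6 : ∀ n → ∃[ u ] u ≤ 3 * n + 1 ×
      6 * (△ n + △ (n / 6)) ≡ 2 * (n * n) + 6 * (△ (n / 2) + △ (n / 3)) + u
△-6 n with n divMod 6
-- For n = r + a * 6 the quotients by 2, 3 and 6 are r / 2 + a * 3, r / 3 + a * 2 and r / 6 + a * 1.
-- For each of the six values of r this leaves a polynomial identity in a.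
... | result a r eq rewrite eq | [r+a*m*d]/d 2 (toℕ r) a 3 | [r+a*m*d]/d 3 (toℕ r) a 2
                          | [r+a*m*d]/d 6 (toℕ r) a 1 = go r
  where
  double : ∀ x y → 6 * (x + y) ≡ 3 * (2 * x + 2 * y)
  double = solve-∀

  6△ : ∀ x y → 6 * (△ x + △ y) ≡ 3 * (x * suc x + y * suc y)
  6△ x y = trans (double (△ x) (△ y)) (cong (3 *_) (cong₂ _+_ (2*△ x) (2*△ y)))

  Goal : ℕ → ℕ → ℕ → ℕ → Set
  Goal r q s t = ∃[ u ] u ≤ 3 * (r + a * 6) + 1 ×
    6 * (△ (r + a * 6) + △ (q + a * 1)) ≡
    2 * ((r + a * 6) * (r + a * 6)) + 6 * (△ (s + a * 3) + △ (t + a * 2)) + u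

  -- Here v is the slack in u ≤ 3 * n + 1, which turns that bound into an identity as well.
  expand : ∀ r s t u v → u + v ≡ 3 * (r + a * 6) + 1 →
    3 * ((r + a * 6) * suc (r + a * 6) + (0 + a * 1) * suc (0 + a * 1)) ≡
    2 * ((r + a * 6) * (r + a * 6)) +
    3 * ((s + a * 3) * suc (s + a * 3) + (t + a * 2) * suc (t + a * 2)) + u →
    Goal r 0 s t
  expand r s t u v u+v eq = u , subst (u ≤_) u+v (m≤m+n u v) ,
    trans (6△ (r + a * 6) (0 + a * 1)) (trans eq
      (cong (λ w → 2 * ((r + a * 6) * (r + a * 6)) + w + u) (sym (6△ (s + a * 3) (t + a * 2)))))

  go : (r : Fin 6) → Goal (toℕ r) (toℕ r / 6) (toℕ r / 2) (toℕ r / 3)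
  go zero = expand 0 0 0 (6 * a) (12 * a + 1) (e a) (e′ a)
    where
    e : ∀ a → 6 * a + (12 * a + 1) ≡ 3 * (0 + a * 6) + 1
    e = solve-∀
    e′ : ∀ a → 3 * ((0 + a * 6) * suc (0 + a * 6) + (0 + a * 1) * suc (0 + a * 1)) ≡
      2 * ((0 + a * 6) * (0 + a * 6)) +
      3 * ((0 + a * 3) * suc (0 + a * 3) + (0 + a * 2) * suc (0 + a * 2)) + 6 * a
    e′ = solve-∀
  go (suc zero) = expand 1 0 0 (18 * a + 4) 0 (e a) (e′ a)
    where
    e : ∀ a → 18 * a + 4 + 0 ≡ 3 * (1 + a * 6) + 1
    e = solve-∀
    e′ : ∀ a → 3 * ((1 + a * 6) * suc (1 + a * 6) + (0 + a * 1) * suc (0 + a * 1)) ≡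
      2 * ((1 + a * 6) * (1 + a * 6)) +
      3 * ((0 + a * 3) * suc (0 + a * 3) + (0 + a * 2) * suc (0 + a * 2)) + (18 * a + 4)
    e′ = solve-∀
  go (suc (suc zero)) = expand 2 1 0 (12 * a + 4) (6 * a + 3) (e a) (e′ a)
    where
    e : ∀ a → 12 * a + 4 + (6 * a + 3) ≡ 3 * (2 + a * 6) + 1
    e = solve-∀
    e′ : ∀ a → 3 * ((2 + a * 6) * suc (2 + a * 6) + (0 + a * 1) * suc (0 + a * 1)) ≡
      2 * ((2 + a * 6) * (2 + a * 6)) +
      3 * ((1 + a * 3) * suc (1 + a * 3) + (0 + a * 2) * suc (0 + a * 2)) + (12 * a + 4)
    e′ = solve-∀
  go (suc (suc (suc zero))) = expand 3 1 1 (12 * a + 6) (6 * a + 4) (e a) (e′ a)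
    where
    e : ∀ a → 12 * a + 6 + (6 * a + 4) ≡ 3 * (3 + a * 6) + 1
    e = solve-∀
    e′ : ∀ a → 3 * ((3 + a * 6) * suc (3 + a * 6) + (0 + a * 1) * suc (0 + a * 1)) ≡
      2 * ((3 + a * 6) * (3 + a * 6)) +
      3 * ((1 + a * 3) * suc (1 + a * 3) + (1 + a * 2) * suc (1 + a * 2)) + (12 * a + 6)
    e′ = solve-∀
  go (suc (suc (suc (suc zero)))) = expand 4 2 1 (6 * a + 4) (12 * a + 9) (e a) (e′ a)
    where
    e : ∀ a → 6 * a + 4 + (12 * a + 9) ≡ 3 * (4 + a * 6) + 1
    e = solve-∀
    e′ : ∀ a → 3 * ((4 + a * 6) * suc (4 + a * 6) + (0 + a * 1) * suc (0 + a * 1)) ≡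
      2 * ((4 + a * 6) * (4 + a * 6)) +
      3 * ((2 + a * 3) * suc (2 + a * 3) + (1 + a * 2) * suc (1 + a * 2)) + (6 * a + 4)
    e′ = solve-∀
  go (suc (suc (suc (suc (suc zero))))) = expand 5 2 1 (18 * a + 16) 0 (e a) (e′ a)
    where
    e : ∀ a → 18 * a + 16 + 0 ≡ 3 * (5 + a * 6) + 1
    e = solve-∀
    e′ : ∀ a → 3 * ((5 + a * 6) * suc (5 + a * 6) + (0 + a * 1) * suc (0 + a * 1)) ≡
      2 * ((5 + a * 6) * (5 + a * 6)) +
      3 * ((2 + a * 3) * suc (2 + a * 3) + (1 + a * 2) * suc (1 + a * 2)) + (18 * a + 16)
    e′ = solve-∀

-- The sieve modulo 6 on a single gcd.

≤partialSum : ∀ (f : Seq ℕ) {i n} .{{_ : NonZero i}} → i ≤ n → f i ≤ partialSum f n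
≤partialSum f {suc i} {suc n} i≤n with suc i ≟ suc n
... | yes refl = m≤n+m (f (suc i)) (partialSum f i)
... | no i≢n   = ≤-trans (≤partialSum f (≤-pred (≤∧≢⇒< i≤n i≢n))) (m≤m+n _ _)

-- For g ≤ J, the indicator of g > 1 and g ≡ ±1 modulo 6.
±1mod6 : ℕ → ℕ → ℕ
±1mod6 J g = δ 5 g + δ 7 g
  + (partialSum (λ j → δ (5 + 6 * j) g) J + partialSum (λ j → δ (7 + 6 * j) g) J)

-- Only the residues 1 and 5 are coprime to 6. Residue 1 gives 1, 7 or 7 + 6 j with j ≥ 1; residue 5
-- gives 5 or 5 + 6 j with j ≥ 1. In both series j ≤ g ≤ J, so the sums up to J reach g.
coprime6⇒1≤ : ∀ J g → g ≤ J → ¬ 2 ∣ g → ¬ 3 ∣ g → 1 ≤ δ 1 g + ±1mod6 J g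
coprime6⇒1≤ J g g≤J 2∤g 3∤g with g divMod 6
... | result q zero eq = contradiction (subst (2 ∣_) (sym eq) (∣n⇒∣m*n q (divides 3 refl))) 2∤g
... | result q (suc (suc zero)) eq =
  contradiction (subst (2 ∣_) (sym eq) (∣m∣n⇒∣m+n (divides 1 refl) (∣n⇒∣m*n q (divides 3 refl)))) 2∤g
... | result q (suc (suc (suc zero))) eq =
  contradiction (subst (3 ∣_) (sym eq) (∣m∣n⇒∣m+n (divides 1 refl) (∣n⇒∣m*n q (divides 2 refl)))) 3∤g
... | result q (suc (suc (suc (suc zero)))) eq =
  contradiction (subst (2 ∣_) (sym eq) (∣m∣n⇒∣m+n (divides 2 refl) (∣n⇒∣m*n q (divides 3 refl)))) 2∤g
... | result zero (suc zero) refl = s≤s z≤n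
... | result (suc zero) (suc zero) refl = s≤s z≤n
... | result (suc (suc q)) (suc zero) eq = begin
  1                                                ≡⟨ ⟦⟧-yes (g ≟ 7 + 6 * suc q) g≡ ⟨
  δ (7 + 6 * suc q) g                              ≤⟨ ≤partialSum (λ j → δ (7 + 6 * j) g) q<J ⟩
  partialSum (λ j → δ (7 + 6 * j) g) J             ≤⟨ m≤n+m _ (partialSum (λ j → δ (5 + 6 * j) g) J) ⟩
  _                                                ≤⟨ m≤n+m _ (δ 5 g + δ 7 g) ⟩
  ±1mod6 J g                                       ≤⟨ m≤n+m _ (δ 1 g) ⟩
  δ 1 g + ±1mod6 J g                               ∎
  where
  open ≤-Reasoning
  e : ∀ q → 1 + suc (suc q) * 6 ≡ 7 + 6 * suc q
  e = solve-∀
  g≡ : g ≡ 7 + 6 * suc q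
  g≡ = trans eq (e q)
  q<J : suc q ≤ J
  q<J = ≤-trans (≤-trans (m≤n*m (suc q) 6) (m≤n+m (6 * suc q) 7)) (subst (_≤ J) g≡ g≤J)
... | result zero (suc (suc (suc (suc (suc zero))))) refl = s≤s z≤n
... | result (suc q) (suc (suc (suc (suc (suc zero))))) eq = begin
  1                                                ≡⟨ ⟦⟧-yes (g ≟ 5 + 6 * suc q) g≡ ⟨
  δ (5 + 6 * suc q) g                              ≤⟨ ≤partialSum (λ j → δ (5 + 6 * j) g) q<J ⟩
  partialSum (λ j → δ (5 + 6 * j) g) J             ≤⟨ m≤m+n _ (partialSum (λ j → δ (7 + 6 * j) g) J) ⟩
  _                                                ≤⟨ m≤n+m _ (δ 5 g + δ 7 g) ⟩
  ±1mod6 J g                                       ≤⟨ m≤n+m _ (δ 1 g) ⟩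
  δ 1 g + ±1mod6 J g                               ∎
  where
  open ≤-Reasoning
  g≡ : g ≡ 5 + 6 * suc q
  g≡ = trans eq (cong (5 +_) (*-comm (suc q) 6))
  q<J : suc q ≤ J
  q<J = ≤-trans (≤-trans (m≤n*m (suc q) 6) (m≤n+m (6 * suc q) 5)) (subst (_≤ J) g≡ g≤J)

-- The indicator of g coprime to 6 is 1 - [2 ∣ g] - [3 ∣ g] + [6 ∣ g]; its negative terms stand on
-- the right to stay within ℕ.
sieve : ∀ J g → g ≤ J →
        [ 1 ∣ g ] + [ 6 ∣ g ] ≤ δ 1 g + ±1mod6 J g + ([ 2 ∣ g ] + [ 3 ∣ g ])
sieve J g g≤J with 2 ∣? g | 3 ∣? g
... | yes 2∣g | yes 3∣g rewrite ⟦⟧-yes (2 ∣? g) 2∣g | ⟦⟧-yes (3 ∣? g) 3∣g =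
  ≤-trans (+-mono-≤ (⟦⟧≤1 (1 ∣? g)) (⟦⟧≤1 (6 ∣? g))) (m≤n+m 2 _)
... | yes 2∣g | no 3∤g
  rewrite ⟦⟧-no (6 ∣? g) (λ 6∣g → 3∤g (∣-trans (divides 2 refl) 6∣g)) | ⟦⟧-yes (2 ∣? g) 2∣g =
  ≤-trans (+-monoˡ-≤ 0 (⟦⟧≤1 (1 ∣? g))) (≤-trans (s≤s z≤n) (m≤n+m _ (δ 1 g + ±1mod6 J g)))
... | no 2∤g  | yes 3∣g
  rewrite ⟦⟧-no (6 ∣? g) (λ 6∣g → 2∤g (∣-trans (divides 3 refl) 6∣g)) | ⟦⟧-yes (3 ∣? g) 3∣g =
  ≤-trans (+-monoˡ-≤ 0 (⟦⟧≤1 (1 ∣? g))) (≤-trans (m≤n+m 1 _) (m≤n+m _ (δ 1 g + ±1mod6 J g)))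
... | no 2∤g  | no 3∤g
  rewrite ⟦⟧-no (6 ∣? g) (λ 6∣g → 2∤g (∣-trans (divides 3 refl) 6∣g)) =
  ≤-trans (+-monoˡ-≤ 0 (≤-trans (⟦⟧≤1 (1 ∣? g)) (coprime6⇒1≤ J g g≤J 2∤g 3∤g)))
    (+-monoʳ-≤ (δ 1 g + ±1mod6 J g) z≤n)

multiple≢ : ∀ m d {g} .{{_ : NonZero d}} → 1 < m → d * m ∣ g → g ≢ d
multiple≢ m d 1<m dm∣d refl = <⇒≱ (m<m*n d m 1<m) (∣⇒≤ dm∣d)

-- After cancelling d, this is the fact that 2 and 3 have least common multiple 6.
*2∣∧*3∣⇒*6∣ : ∀ {d g} .{{_ : NonZero d}} → d ∣ g → d * 2 ∣ g → d * 3 ∣ g → d * 6 ∣ g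
*2∣∧*3∣⇒*6∣ {d} (divides-refl h) 2d∣g 3d∣g = subst (d * 6 ∣_) (*-comm d h) (*-monoʳ-∣ d (lcm-least
  (*-cancelˡ-∣ d (subst (d * 2 ∣_) (*-comm h d) 2d∣g))
  (*-cancelˡ-∣ d (subst (d * 3 ∣_) (*-comm h d) 3d∣g))))

-- If g = d, then g / d = 1 is coprime to 6. So g = d is at most as frequent as d ∣ g with g / d
-- coprime to 6, and inclusion-exclusion expresses the latter.
δ-sieve : ∀ d g .{{_ : NonZero d}} →
          δ d g + ([ d * 2 ∣ g ] + [ d * 3 ∣ g ]) ≤ [ d ∣ g ] + [ d * 6 ∣ g ]
δ-sieve d g with d ∣? g
... | no d∤g
  rewrite ⟦⟧-no (g ≟ d) (λ g≡d → d∤g (subst (d ∣_) (sym g≡d) ∣-refl))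
        | ⟦⟧-no (d * 2 ∣? g) (λ 2d∣g → d∤g (∣-trans (m∣m*n 2) 2d∣g))
        | ⟦⟧-no (d * 3 ∣? g) (λ 3d∣g → d∤g (∣-trans (m∣m*n 3) 3d∣g)) = z≤n
... | yes d∣g with d * 2 ∣? g | d * 3 ∣? g
...   | no _ | no _ = ≤-trans (+-monoˡ-≤ 0 (⟦⟧≤1 (g ≟ d))) (s≤s z≤n)
...   | yes 2d∣g | no _ rewrite ⟦⟧-no (g ≟ d) (multiple≢ 2 d (s≤s (s≤s z≤n)) 2d∣g) = s≤s z≤n
...   | no _ | yes 3d∣g rewrite ⟦⟧-no (g ≟ d) (multiple≢ 3 d (s≤s (s≤s z≤n)) 3d∣g) = s≤s z≤n
...   | yes 2d∣g | yes 3d∣g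
  rewrite ⟦⟧-no (g ≟ d) (multiple≢ 2 d (s≤s (s≤s z≤n)) 2d∣g)
        | ⟦⟧-yes (d * 6 ∣? g) (*2∣∧*3∣⇒*6∣ d∣g 2d∣g 3d∣g) = ≤-refl

-- Counts of pairs obtained from the sieve.

gcdSum-∣* : ∀ d m n .{{_ : NonZero d}} .{{_ : NonZero m}} → gcdSum [ d * m ∣_] n ≡ △ (n / d / m)
gcdSum-∣* d m n = trans (gcdSum-∣ (d * m) n) (cong △ (sym (m/n/o≡m/[n*o] n d m)))
  where instance
  _ : NonZero (d * m)
  _ = m*n≢0 d m

-- Writing n / (d * m) as n / d / m makes the bound depend on q = n / d alone, in the shape of `△-6`
-- at q.
δ-count : ∀ d n .{{_ : NonZero d}} →
  gcdSum (δ d) n + (△ (n / d / 2) + △ (n / d / 3)) ≤ △ (n / d) + △ (n / d / 6)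
δ-count d n = subst₂ _≤_ lhs rhs (gcdSum-mono n (λ g _ → δ-sieve d g))
  where
  lhs : gcdSum (λ g → δ d g + ([ d * 2 ∣ g ] + [ d * 3 ∣ g ])) n ≡
        gcdSum (δ d) n + (△ (n / d / 2) + △ (n / d / 3))
  lhs = trans (gcdSum-+ (δ d) (λ g → [ d * 2 ∣ g ] + [ d * 3 ∣ g ]) n) (cong (gcdSum (δ d) n +_)
    (trans (gcdSum-+ [ d * 2 ∣_] [ d * 3 ∣_] n) (cong₂ _+_ (gcdSum-∣* d 2 n) (gcdSum-∣* d 3 n))))
  rhs : gcdSum (λ g → [ d ∣ g ] + [ d * 6 ∣ g ]) n ≡ △ (n / d) + △ (n / d / 6)
  rhs = trans (gcdSum-+ [ d ∣_] [ d * 6 ∣_] n) (cong₂ _+_ (gcdSum-∣ d n) (gcdSum-∣* d 6 n))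

gcdSum-±1mod6 : ℕ → ℕ
gcdSum-±1mod6 n = gcdSum (δ 5) n + gcdSum (δ 7) n
  + (partialSum (λ j → gcdSum (δ (5 + 6 * j)) n) n + partialSum (λ j → gcdSum (δ (7 + 6 * j)) n) n)

sieve-count : ∀ n →
  △ n + △ (n / 6) ≤ gcdSum (δ 1) n + gcdSum (±1mod6 n) n + (△ (n / 2) + △ (n / 3))
sieve-count n = subst₂ _≤_ lhs rhs (gcdSum-mono n (sieve n))
  where
  lhs : gcdSum (λ g → [ 1 ∣ g ] + [ 6 ∣ g ]) n ≡ △ n + △ (n / 6)
  lhs = trans (gcdSum-+ [ 1 ∣_] [ 6 ∣_] n)
    (cong₂ _+_ (trans (gcdSum-∣ 1 n) (cong △ (n/1≡n n))) (gcdSum-∣ 6 n))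
  rhs : gcdSum (λ g → δ 1 g + ±1mod6 n g + ([ 2 ∣ g ] + [ 3 ∣ g ])) n ≡
        gcdSum (δ 1) n + gcdSum (±1mod6 n) n + (△ (n / 2) + △ (n / 3))
  rhs = trans (gcdSum-+ (λ g → δ 1 g + ±1mod6 n g) (λ g → [ 2 ∣ g ] + [ 3 ∣ g ]) n) (cong₂ _+_
    (gcdSum-+ (δ 1) (±1mod6 n) n)
    (trans (gcdSum-+ [ 2 ∣_] [ 3 ∣_] n) (cong₂ _+_ (gcdSum-∣ 2 n) (gcdSum-∣ 3 n))))

gcdSum-±1mod6≡ : ∀ n → gcdSum (±1mod6 n) n ≡ gcdSum-±1mod6 n
gcdSum-±1mod6≡ n = trans (gcdSum-+ (λ g → δ 5 g + δ 7 g) (λ g → F g + G g) n) (cong₂ _+_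
  (gcdSum-+ (δ 5) (δ 7) n)
  (trans (gcdSum-+ F G n)
    (cong₂ _+_ (gcdSum-∑ (λ j → δ (5 + 6 * j)) n n) (gcdSum-∑ (λ j → δ (7 + 6 * j)) n n))))
  where
  F G : ℕ → ℕ
  F g = partialSum (λ j → δ (5 + 6 * j) g) n
  G g = partialSum (λ j → δ (7 + 6 * j) g) n

-- Evaluating the right side of `δ-count` by `△-6` at q cancels the terms for q / 2 and q / 3 and
-- leaves 2 q² + u.
δ-bound : ∀ d n .{{_ : NonZero d}} →
          6 * gcdSum (δ d) n ≤ 2 * (n / d * (n / d)) + (3 * (n / d) + 1)
δ-bound d n with u , u≤ , eq ← △-6 (n / d) = +-cancelʳ-≤ (6 * B) _ _ (begin
  6 * G + 6 * B               ≡⟨ *-distribˡ-+ 6 G B ⟨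
  6 * (G + B)                 ≤⟨ *-monoʳ-≤ 6 (δ-count d n) ⟩
  6 * (△ q + △ (q / 6))       ≡⟨ eq ⟩
  2 * (q * q) + 6 * B + u     ≤⟨ +-monoʳ-≤ (2 * (q * q) + 6 * B) u≤ ⟩
  2 * (q * q) + 6 * B + (3 * q + 1) ≡⟨ rearrange (2 * (q * q)) (6 * B) (3 * q + 1) ⟩
  2 * (q * q) + (3 * q + 1) + 6 * B ∎)
  where
  open ≤-Reasoning
  q = n / d
  G = gcdSum (δ d) n
  B = △ (q / 2) + △ (q / 3)
  rearrange : ∀ x y z → x + y + z ≡ x + z + y
  rearrange = solve-∀

150q≤ : ∀ q → 150 * q ≤ q * q + 22500
150q≤ q with ≤-total q 150
... | inj₁ q≤150 = ≤-trans (*-monoʳ-≤ 150 q≤150) (m≤n+m 22500 (q * q))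
... | inj₂ 150≤q = ≤-trans (*-monoˡ-≤ q 150≤q) (m≤m+n (q * q) 22500)

-- The linear error 150 q is absorbed into one extra q² and a constant. Left as a multiple of n / d
-- it would sum to order n log n; a constant for each of 2 n + 2 divisors costs only O(n).
300*δ≤ : ∀ d n .{{_ : NonZero d}} →
          300 * gcdSum (δ d) n ≤ 101 * (n / d * (n / d)) + 22550
300*δ≤ d n = begin
  300 * G                            ≡⟨ *-assoc 50 6 G ⟩
  50 * (6 * G)                       ≤⟨ *-monoʳ-≤ 50 (δ-bound d n) ⟩
  50 * (2 * (q * q) + (3 * q + 1))   ≡⟨ expand q ⟩
  100 * (q * q) + (150 * q + 50)     ≤⟨ +-monoʳ-≤ (100 * (q * q)) (+-monoˡ-≤ 50 (150q≤ q)) ⟩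
  100 * (q * q) + (q * q + 22500 + 50) ≡⟨ cong (100 * (q * q) +_) (+-assoc (q * q) 22500 50) ⟩
  100 * (q * q) + (q * q + 22550)    ≡⟨ collect (q * q) 22550 ⟩
  101 * (q * q) + 22550              ∎
  where
  open ≤-Reasoning
  q = n / d
  G = gcdSum (δ d) n
  expand : ∀ q → 50 * (2 * (q * q) + (3 * q + 1)) ≡ 100 * (q * q) + (150 * q + 50)
  expand = solve-∀
  collect : ∀ x k → 100 * x + (x + k) ≡ 101 * x + k
  collect = solve-∀

-- Sums of squared quotients over the divisors ±1 modulo 6.

sq/ : ℕ → (d : ℕ) .{{_ : NonZero d}} → ℕ
sq/ n d = n / d * (n / d)

-- The divisors are visibly nonzero in the form `suc c + 6 * j`. As j starts at 1, c = 4 gives 11,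
-- 17, ... and c = 6 gives 13, 19, ....
∑sq/ : ℕ → ℕ → ℕ → ℕ
∑sq/ c n = partialSum (λ j → sq/ n (suc c + 6 * j))

sq/≤ : ∀ n d .{{_ : NonZero d}} → d * d * sq/ n d ≤ n * n
sq/≤ n d = begin
  d * d * (n / d * (n / d))     ≡⟨ rearrange d (n / d) ⟩
  n / d * d * (n / d * d)       ≤⟨ *-mono-≤ (m/n*n≤m n d) (m/n*n≤m n d) ⟩
  n * n                         ∎
  where
  open ≤-Reasoning
  rearrange : ∀ d q → d * d * (q * q) ≡ q * d * (q * d)
  rearrange = solve-∀

-- Telescoping: 1 / d² ≤ 1 / (d² - 9) = (1 / (d - 3) - 1 / (d + 3)) / 6.
∑sq/-telescope : ∀ c n J →
  (4 + c) * (4 + c + 6 * J) * ∑sq/ c n J ≤ J * (n * n)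
∑sq/-telescope c n zero    = ≤-reflexive (*-zeroʳ ((4 + c) * (4 + c + 0)))
∑sq/-telescope c n (suc J) = *-cancelˡ-≤ (4 + c + 6 * J) (begin
  D * ((4 + c) * (4 + c + 6 * suc J) * (S + s))
    ≡⟨ split c J S s ⟩
  (D + 6) * ((4 + c) * D * S) + (4 + c) * (D * (D + 6) * s)
    ≤⟨ +-mono-≤ (*-monoʳ-≤ (D + 6) (∑sq/-telescope c n J)) (*-monoʳ-≤ (4 + c) term) ⟩
  (D + 6) * (J * (n * n)) + (4 + c) * (n * n)
    ≡⟨ merge c J (n * n) ⟩
  D * (suc J * (n * n)) ∎)
  where
  open ≤-Reasoning
  -- For the new divisor d = suc c + 6 * suc J, D is d - 3 and D + 6 is d + 3, so D * (D + 6) = d² -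
  -- 9. Multiplying the goal by D brings in the factor `(4 + c) * D` of the induction hypothesis.
  D = 4 + c + 6 * J
  S = ∑sq/ c n J
  s = sq/ n (suc c + 6 * suc J)
  split : ∀ c J S s →
    (4 + c + 6 * J) * ((4 + c) * (4 + c + 6 * suc J) * (S + s)) ≡
    (4 + c + 6 * J + 6) * ((4 + c) * (4 + c + 6 * J) * S) +
    (4 + c) * ((4 + c + 6 * J) * (4 + c + 6 * J + 6) * s)
  split = solve-∀
  merge : ∀ c J N → (4 + c + 6 * J + 6) * (J * N) + (4 + c) * N ≡ (4 + c + 6 * J) * (suc J * N)
  merge = solve-∀
  complete : ∀ c J s → (4 + c + 6 * J) * (4 + c + 6 * J + 6) * s + 9 * s ≡
    (suc c + 6 * suc J) * (suc c + 6 * suc J) * s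
  complete = solve-∀
  term : D * (D + 6) * s ≤ n * n
  term = begin
    D * (D + 6) * s           ≤⟨ m≤m+n _ (9 * s) ⟩
    D * (D + 6) * s + 9 * s   ≡⟨ complete c J s ⟩
    (suc c + 6 * suc J) * (suc c + 6 * suc J) * s ≤⟨ sq/≤ n (suc c + 6 * suc J) ⟩
    n * n                     ∎

-- At J = n the factor 4 + c + 6 * n is at least 6 * n, and n cancels. What remains is the sum of
-- the infinite telescoping series, 1 / (6 (4 + c)).
∑sq/≤ : ∀ c n .{{_ : NonZero n}} → 6 * (4 + c) * ∑sq/ c n n ≤ n * n
∑sq/≤ c n = *-cancelˡ-≤ n (begin
  n * (6 * (4 + c) * S)                              ≤⟨ m≤n+m _ ((4 + c) * (4 + c) * S) ⟩
  (4 + c) * (4 + c) * S + n * (6 * (4 + c) * S)      ≡⟨ rearrange c n S ⟩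
  (4 + c) * (4 + c + 6 * n) * S                      ≤⟨ ∑sq/-telescope c n n ⟩
  n * (n * n)                                        ∎)
  where
  open ≤-Reasoning
  S = ∑sq/ c n n
  rearrange : ∀ c n S → (4 + c) * (4 + c) * S + n * (6 * (4 + c) * S) ≡ (4 + c) * (4 + c + 6 * n) * S
  rearrange = solve-∀

-- The divisors 5 and 7 stay outside the telescoping series: starting these at 5 and 7 would give
-- 1/12 + 1/24 = 1/8, whereas the argument needs a total below 1/10.
squares : ℕ → ℕ
squares n = sq/ n 5 + sq/ n 7 + (∑sq/ 4 n n + ∑sq/ 6 n n)

scale : ∀ a b {u} x y → a * x ≤ y → u ≡ b * a → u * x ≤ b * y
scale a b x y ax≤y refl = begin
  b * a * x     ≡⟨ *-assoc b a x ⟩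
  b * (a * x)   ≤⟨ *-monoʳ-≤ b ax≤y ⟩
  b * y         ∎
  where open ≤-Reasoning

∑-scale : ∀ u b₁ b₂ b₃ b₄ x₁ x₂ x₃ x₄ y →
  u * x₁ ≤ b₁ * y → u * x₂ ≤ b₂ * y → u * x₃ ≤ b₃ * y → u * x₄ ≤ b₄ * y →
  u * (x₁ + x₂ + (x₃ + x₄)) ≤ (b₁ + b₂ + (b₃ + b₄)) * y
∑-scale u b₁ b₂ b₃ b₄ x₁ x₂ x₃ x₄ y h₁ h₂ h₃ h₄ = begin
  u * (x₁ + x₂ + (x₃ + x₄))                    ≡⟨ l u x₁ x₂ x₃ x₄ ⟩
  u * x₁ + u * x₂ + (u * x₃ + u * x₄)          ≤⟨ +-mono-≤ (+-mono-≤ h₁ h₂) (+-mono-≤ h₃ h₄) ⟩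
  b₁ * y + b₂ * y + (b₃ * y + b₄ * y)          ≡⟨ r b₁ b₂ b₃ b₄ y ⟩
  (b₁ + b₂ + (b₃ + b₄)) * y                    ∎
  where
  open ≤-Reasoning
  l : ∀ u a b c d → u * (a + b + (c + d)) ≡ u * a + u * b + (u * c + u * d)
  l = solve-∀
  r : ∀ a b c d y → a * y + b * y + (c * y + d * y) ≡ (a + b + (c + d)) * y
  r = solve-∀

-- 1/25 + 1/49 + 1/48 + 1/60 = 5757/58800
squares≤ : ∀ n .{{_ : NonZero n}} → 58800 * squares n ≤ 5757 * (n * n)
squares≤ n = ∑-scale 58800 2352 1200 1225 980 (sq/ n 5) (sq/ n 7) (∑sq/ 4 n n) (∑sq/ 6 n n) (n * n)
  (scale 25 2352 (sq/ n 5) (n * n) (sq/≤ n 5) refl)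
  (scale 49 1200 (sq/ n 7) (n * n) (sq/≤ n 7) refl)
  (scale 48 1225 (∑sq/ 4 n n) (n * n) (∑sq/≤ 4 n) refl)
  (scale 60 980 (∑sq/ 6 n n) (n * n) (∑sq/≤ 6 n) refl)

-- The lower bound for `Φ`.

300*∑δ≤ : ∀ c n → 300 * partialSum (λ j → gcdSum (δ (suc c + 6 * j)) n) n ≤
               101 * ∑sq/ c n n + n * 22550
300*∑δ≤ c n = begin
  300 * partialSum (λ j → gcdSum (δ (suc c + 6 * j)) n) n
    ≡⟨ partialSum-*ˡ 300 (λ j → gcdSum (δ (suc c + 6 * j)) n) n ⟨
  partialSum (λ j → 300 * gcdSum (δ (suc c + 6 * j)) n) n
    ≤⟨ partialSum-mono n (λ j _ → 300*δ≤ (suc c + 6 * j) n) ⟩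
  partialSum (λ j → 101 * sq/ n (suc c + 6 * j) + 22550) n
    ≡⟨ partialSum-+ (λ j → 101 * sq/ n (suc c + 6 * j)) (λ _ → 22550) n ⟩
  partialSum (λ j → 101 * sq/ n (suc c + 6 * j)) n + partialSum (λ _ → 22550) n
    ≡⟨ cong₂ _+_ (partialSum-*ˡ 101 (λ j → sq/ n (suc c + 6 * j)) n) (partialSum-const 22550 n) ⟩
  101 * ∑sq/ c n n + n * 22550 ∎
  where open ≤-Reasoning

-- The error 22550 occurs once for 5, once for 7 and n times in each series.
300*gcdSum-±1mod6≤ : ∀ n → 300 * gcdSum-±1mod6 n ≤ 101 * squares n + (2 * n + 2) * 22550
300*gcdSum-±1mod6≤ n = begin
  300 * gcdSum-±1mod6 n
    ≡⟨ l 300 (gcdSum (δ 5) n) (gcdSum (δ 7) n) (F 4) (F 6) ⟩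
  300 * gcdSum (δ 5) n + 300 * gcdSum (δ 7) n + (300 * F 4 + 300 * F 6)
    ≤⟨ +-mono-≤ (+-mono-≤ (300*δ≤ 5 n) (300*δ≤ 7 n)) (+-mono-≤ (300*∑δ≤ 4 n) (300*∑δ≤ 6 n)) ⟩
  _ ≡⟨ r 101 22550 n (sq/ n 5) (sq/ n 7) (∑sq/ 4 n n) (∑sq/ 6 n n) ⟩
  101 * squares n + (2 * n + 2) * 22550 ∎
  where
  open ≤-Reasoning
  F : ℕ → ℕ
  F c = partialSum (λ j → gcdSum (δ (suc c + 6 * j)) n) n
  l : ∀ u a b c d → u * (a + b + (c + d)) ≡ u * a + u * b + (u * c + u * d)
  l = solve-∀
  r : ∀ h k n a b c d → h * a + k + (h * b + k) + (h * c + n * k + (h * d + n * k)) ≡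
      h * (a + b + (c + d)) + (2 * n + 2) * k
  r = solve-∀

-- `sieve-count` bounds from above what `△-6` evaluates as n² / 3 + u / 6, and u is nonnegative.
n²≤3*gcdSum : ∀ n → n * n ≤ 3 * (gcdSum (δ 1) n + gcdSum-±1mod6 n)
n²≤3*gcdSum n with u , _ , eq ← △-6 n = *-cancelˡ-≤ 2 (+-cancelʳ-≤ (6 * B) _ _ (begin
  2 * (n * n) + 6 * B                 ≤⟨ m≤m+n _ u ⟩
  2 * (n * n) + 6 * B + u             ≡⟨ eq ⟨
  6 * (△ n + △ (n / 6))               ≤⟨ *-monoʳ-≤ 6 (sieve-count n) ⟩
  6 * (gcdSum (δ 1) n + gcdSum (±1mod6 n) n + B) ≡⟨ cong (λ e → 6 * (gcdSum (δ 1) n + e + B)) (gcdSum-±1mod6≡ n) ⟩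
  6 * (X + B)                         ≡⟨ rearrange X B ⟩
  2 * (3 * X) + 6 * B                 ∎))
  where
  open ≤-Reasoning
  B = △ (n / 2) + △ (n / 3)
  X = gcdSum (δ 1) n + gcdSum-±1mod6 n
  rearrange : ∀ x b → 6 * (x + b) ≡ 2 * (3 * x) + 6 * b
  rearrange = solve-∀

-- Here v / u bounds the sum of 1 / d², w is 30 u, and e = 10 u - 101 v is the margin left after
-- comparing the quadratic terms. It has to outweigh the linear error: u C < e N.
3N<10P : ∀ {u v w e N P E S C} .{{_ : NonZero w}} →
  u * 100 ≡ 101 * v + 3 * w + e → u * 300 ≡ w * 10 →
  N ≤ 3 * (P + E) → 300 * E ≤ 101 * S + C → u * S ≤ v * N → u * C < e * N →
  3 * N < 10 * P
3N<10P {u} {v} {w} {e} {N} {P} {E} {S} {C} p q h₁ h₂ h₃ h₄ =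
  *-cancelˡ-< w _ _ (+-cancelʳ-< (101 * (v * N) + e * N) _ _ (begin-strict
  w * (3 * N) + (101 * (v * N) + e * N)       ≡⟨ i₁ v w e N ⟩
  (101 * v + 3 * w + e) * N                   ≡⟨ cong (_* N) p ⟨
  u * 100 * N                                 ≤⟨ *-monoʳ-≤ (u * 100) h₁ ⟩
  u * 100 * (3 * (P + E))                     ≡⟨ i₂ u P E ⟩
  u * 300 * P + u * (300 * E)                 ≤⟨ +-monoʳ-≤ _ (*-monoʳ-≤ u h₂) ⟩
  u * 300 * P + u * (101 * S + C)             ≡⟨ cong₂ _+_ (cong (_* P) q) (i₃ u S C) ⟩
  w * 10 * P + (101 * (u * S) + u * C)        <⟨ +-monoʳ-< (w * 10 * P) (+-mono-≤-< (*-monoʳ-≤ 101 h₃) h₄) ⟩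
  w * 10 * P + (101 * (v * N) + e * N)        ≡⟨ cong (_+ (101 * (v * N) + e * N)) (*-assoc w 10 P) ⟩
  w * (10 * P) + (101 * (v * N) + e * N)      ∎))
  where
  open ≤-Reasoning
  i₁ : ∀ v w e N → w * (3 * N) + (101 * (v * N) + e * N) ≡ (101 * v + 3 * w + e) * N
  i₁ = solve-∀
  i₂ : ∀ u P E → u * 100 * (3 * (P + E)) ≡ u * 300 * P + u * (300 * E)
  i₂ = solve-∀
  i₃ : ∀ u S C → u * (101 * S + C) ≡ 101 * (u * S) + u * C
  i₃ = solve-∀

-- As n ≥ 1, 2 n + 2 is at most 4 n; dividing by n leaves 4 u k < e n.
linear<quadratic : ∀ {u k e M n} .{{_ : NonZero n}} → u * (4 * k) < e * M → M ≤ n →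
                   u * ((2 * n + 2) * k) < e * (n * n)
linear<quadratic {u} {k} {e} {M} {n} h M≤n = begin-strict
  u * ((2 * n + 2) * k)       ≤⟨ *-monoʳ-≤ u (*-monoˡ-≤ k (+-monoʳ-≤ (2 * n) (*-monoʳ-≤ 2 (>-nonZero⁻¹ n)))) ⟩
  u * ((2 * n + 2 * n) * k)   ≡⟨ i₁ u n k ⟩
  u * (4 * k) * n             <⟨ *-monoˡ-< n h ⟩
  e * M * n                   ≤⟨ *-monoˡ-≤ n (*-monoʳ-≤ e M≤n) ⟩
  e * n * n                   ≡⟨ *-assoc e n n ⟩
  e * (n * n)                 ∎
  where
  open ≤-Reasoning
  i₁ : ∀ u n k → u * ((2 * n + 2 * n) * k) ≡ u * (4 * k) * n
  i₁ = solve-∀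

3n²<10Φ : ∀ n .{{_ : NonZero n}} → 1000000 ≤ n → 3 * (n * n) < 10 * Φ n
3n²<10Φ n M≤n = subst (λ x → 3 * (n * n) < 10 * x) (sym (Φ≡gcdSum n))
  (3N<10P {58800} {5757} {1764000} {6543} {n * n} {gcdSum (δ 1) n}
    {gcdSum-±1mod6 n} {squares n} {(2 * n + 2) * 22550} refl refl
    (n²≤3*gcdSum n) (300*gcdSum-±1mod6≤ n) (squares≤ n)
    -- The threshold must exceed 4 * 58800 * 22550 / 6543, about 810600.
    (linear<quadratic {58800} {22550} {6543} {1000000} (<ᵇ⇒< _ _ tt) M≤n))

-- The upper bound for `Φ`.

φ<n : ∀ n → 1 < n → .{{_ : NonZero n}} → φ n < n
φ<n (suc n) 1<n = begin-strict
  φ (suc n)                                            ≡⟨ φ≡ (suc n) ⟩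
  partialSum (λ k → δ 1 (gcd k (suc n))) n + δ 1 (gcd (suc n) (suc n))
    -- The last candidate k = suc n is not coprime to itself.
    ≡⟨ cong (partialSum (λ k → δ 1 (gcd k (suc n))) n +_) (⟦⟧-no (gcd (suc n) (suc n) ≟ 1) gcd≢1) ⟩
  partialSum (λ k → δ 1 (gcd k (suc n))) n + 0         ≡⟨ +-identityʳ _ ⟩
  partialSum (λ k → δ 1 (gcd k (suc n))) n             ≤⟨ partialSum-mono n (λ k _ → ⟦⟧≤1 (gcd k (suc n) ≟ 1)) ⟩
  partialSum (λ _ → 1) n                               ≡⟨ trans (partialSum-const 1 n) (*-identityʳ n) ⟩
  n                                                    <⟨ ≤-refl ⟩
  suc n                                                ∎
  where
  open ≤-Reasoning
  gcd≢1 : gcd (suc n) (suc n) ≢ 1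
  gcd≢1 eq = >⇒≢ 1<n (∣1⇒≡1 (subst (suc n ∣_) eq (gcd-greatest ∣-refl ∣-refl)))

-- Induction from n = 6, where 30 < 36; at 4 and 5 the two sides are equal. A step adds 2 n + 1 on
-- the right and at most that on the left, since φ (suc n) ≤ n.
2Φ+n<n² : ∀ n .{{_ : NonZero n}} → 6 ≤ n → 2 * Φ n + n < n * n
2Φ+n<n² n 6≤n with m≤n⇒∃[o]m+o≡n 6≤n
... | k , refl = subst (λ n → 2 * partialSum φ n + n < n * n) (+-comm k 6) (go k)
  where
  open ≤-Reasoning
  i₁ : ∀ p n → 2 * (p + n) + suc n ≡ 2 * p + n + (2 * n + 1)
  i₁ = solve-∀
  i₂ : ∀ n → n * n + (2 * n + 1) ≡ suc n * suc n
  i₂ = solve-∀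
  go : ∀ k → 2 * partialSum φ (k + 6) + (k + 6) < (k + 6) * (k + 6)
  go zero    = <ᵇ⇒< 30 36 tt
  go (suc k) = begin-strict
    2 * (p + φ (suc m)) + suc m   ≤⟨ +-monoˡ-≤ (suc m) (*-monoʳ-≤ 2 (+-monoʳ-≤ p φ≤m)) ⟩
    2 * (p + m) + suc m           ≡⟨ i₁ p m ⟩
    2 * p + m + (2 * m + 1)       <⟨ +-monoˡ-< (2 * m + 1) (go k) ⟩
    m * m + (2 * m + 1)           ≡⟨ i₂ m ⟩
    suc m * suc m                 ∎
    where
    m = k + 6
    p = partialSum φ m
    φ≤m : φ (suc m) ≤ m
    φ≤m = ≤-pred (φ<n (suc m) (s≤s (m≤n⇒m≤o+n k (s≤s z≤n))))

-- Transfer to rational sequences.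

open import Data.Integer.Base using (+_)

ι : ℕ → ℚ
ι n = + n ℚ./ 1

-- `ℚ./` divides by a gcd that does not compute for a variable n. Among unnormalised rationals the
-- denominator is plainly 1, so the laws of `ι` are checked there.
toℚᵘ-ι : ∀ n → ℚ.toℚᵘ (ι n) ℚᵘ.≃ mkℚᵘ (+ n) 0
toℚᵘ-ι n = ℚ.toℚᵘ-fromℚᵘ (mkℚᵘ (+ n) 0)

ι-+ : ∀ m n → ι (m + n) ≡ ι m ℚ.+ ι n
ι-+ m n = ℚ.toℚᵘ-injective (begin
  ℚ.toℚᵘ (ι (m + n))                        ≈⟨ toℚᵘ-ι (m + n) ⟩
  mkℚᵘ (+ (m + n)) 0                        ≡⟨ cong (λ i → mkℚᵘ i 0) (cong₂ ℤ._+_ (ℤ.*-identityʳ (+ m)) (ℤ.*-identityʳ (+ n))) ⟨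
  mkℚᵘ (+ m) 0 ℚᵘ.+ mkℚᵘ (+ n) 0            ≈⟨ ℚᵘ.+-cong (toℚᵘ-ι m) (toℚᵘ-ι n) ⟨
  ℚ.toℚᵘ (ι m) ℚᵘ.+ ℚ.toℚᵘ (ι n)            ≈⟨ ℚ.toℚᵘ-homo-+ (ι m) (ι n) ⟨
  ℚ.toℚᵘ (ι m ℚ.+ ι n)                      ∎)
  where open import Relation.Binary.Reasoning.Setoid ℚᵘ.≃-setoid

ι-* : ∀ m n → ι (m * n) ≡ ι m ℚ.* ι n
ι-* m n = ℚ.toℚᵘ-injective (begin
  ℚ.toℚᵘ (ι (m * n))                        ≈⟨ toℚᵘ-ι (m * n) ⟩
  mkℚᵘ (+ (m * n)) 0                        ≡⟨ cong (λ i → mkℚᵘ i 0) (ℤ.pos-* m n) ⟩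
  mkℚᵘ (+ m) 0 ℚᵘ.* mkℚᵘ (+ n) 0            ≈⟨ ℚᵘ.*-cong (toℚᵘ-ι m) (toℚᵘ-ι n) ⟨
  ℚ.toℚᵘ (ι m) ℚᵘ.* ℚ.toℚᵘ (ι n)            ≈⟨ ℚ.toℚᵘ-homo-* (ι m) (ι n) ⟨
  ℚ.toℚᵘ (ι m ℚ.* ι n)                      ∎)
  where open import Relation.Binary.Reasoning.Setoid ℚᵘ.≃-setoid

ι-mono-< : ∀ {m n} → m < n → ι m ℚ.< ι n
ι-mono-< {m} {n} m<n = ℚ.toℚᵘ-cancel-<
  (ℚᵘ.<-respˡ-≃ (ℚᵘ.≃-sym (toℚᵘ-ι m)) (ℚᵘ.<-respʳ-≃ (ℚᵘ.≃-sym (toℚᵘ-ι n))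
    (ℚᵘ.*<* (ℤ.*-monoʳ-<-pos (+ 1) (ℤ.+<+ m<n)))))

ι-mono-≤ : ∀ {m n} → m ≤ n → ι m ℚ.≤ ι n
ι-mono-≤ {m} {n} m≤n = ℚ.toℚᵘ-cancel-≤
  (ℚᵘ.≤-respˡ-≃ (ℚᵘ.≃-sym (toℚᵘ-ι m)) (ℚᵘ.≤-respʳ-≃ (ℚᵘ.≃-sym (toℚᵘ-ι n))
    (ℚᵘ.*≤* (ℤ.*-monoʳ-≤-nonNeg (+ 1) (ℤ.+≤+ m≤n)))))

3/10*ι< : ∀ N p → 3 * N < 10 * p → (+ 3 ℚ./ 10) ℚ.* ι N ℚ.< ι p
3/10*ι< N p h = ℚ.*-cancelˡ-<-nonNeg (ι 10) (begin-strict
  ι 10 ℚ.* ((+ 3 ℚ./ 10) ℚ.* ι N)   ≡⟨ ℚ.*-assoc (ι 10) (+ 3 ℚ./ 10) (ι N) ⟨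
  -- The closed product of `ι 10` and 3/10 evaluates to `ι 3`.
  ι 3 ℚ.* ι N                       ≡⟨ ι-* 3 N ⟨
  ι (3 * N)                         <⟨ ι-mono-< h ⟩
  ι (10 * p)                        ≡⟨ ι-* 10 p ⟩
  ι 10 ℚ.* ι p                      ∎)
  where open ℚ.≤-Reasoning

ι<÷2 : ∀ N n p → 2 * p + n < N → ι p ℚ.< (ι N ℚ.- ι n) ℚ.÷ (+ 2 ℚ./ 1)
ι<÷2 N n p h = begin-strict
  ι p                                  ≡⟨ ℚ.*-identityʳ (ι p) ⟨
  ι p ℚ.* (ι 2 ℚ.* ℚ.½)                ≡⟨ ℚ.*-assoc (ι p) (ι 2) ℚ.½ ⟨
  ι p ℚ.* ι 2 ℚ.* ℚ.½                  ≡⟨ cong (ℚ._* ℚ.½) (trans (sym (ι-* p 2)) (cong ι (*-comm p 2))) ⟩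
  ι (2 * p) ℚ.* ℚ.½                    ≡⟨ cong (ℚ._* ℚ.½) cancel ⟨
  (ι (2 * p + n) ℚ.- ι n) ℚ.* ℚ.½      <⟨ ℚ.*-monoˡ-<-pos ℚ.½ (ℚ.+-monoˡ-< (ℚ.- ι n) (ι-mono-< h)) ⟩
  (ι N ℚ.- ι n) ℚ.* ℚ.½                ∎
  where
  open ℚ.≤-Reasoning
  cancel : ι (2 * p + n) ℚ.- ι n ≡ ι (2 * p)
  cancel = trans (cong (ℚ._- ι n) (ι-+ (2 * p) n)) (trans (ℚ.+-assoc (ι (2 * p)) (ι n) (ℚ.- ι n))
    (trans (cong (ι (2 * p) ℚ.+_) (ℚ.+-inverseʳ (ι n))) (ℚ.+-identityʳ (ι (2 * p)))))

theorem10 : (σ 𝕀 ≗ₛ Φ)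
          × (⌜ σ 𝕀 ⌝ ≈𝓕 α *ₛ α)
          × (const (+ 3 ℚ./ 10) *ₛ (α *ₛ α) <𝓕 ⌜ σ 𝕀 ⌝)
          × (⌜ σ 𝕀 ⌝ <𝓕 (α *ₛ α -ₛ α) ÷ₛ (+ 2 ℚ./ 1))
theorem10 = σ𝕀≗Φ
  -- The constants 10 and 1 come from the strict bounds: 3 n² < 10 Φ gives n² ≤ 10 Φ, and 2 Φ + n <
  -- n² gives Φ ≤ n².
  , ((10 , _ , 1000000 , λ n M≤n → order (ι-* n n) (ι-* 10 (σ 𝕀 n)) (n²≤10σ n M≤n))
    , (1 , _ , 6 , λ n 6≤n → order′ (ι-* n n) (σ≤n² n 6≤n)))
  , (1000000 , λ n M≤n → subst₂ (λ N p → (+ 3 ℚ./ 10) ℚ.* N ℚ.< ι p) (ι-* n n) (sym (σ𝕀≗Φ n))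
      (3/10*ι< (n * n) (Φ n) (3n²<10Φ n M≤n)))
  , (6 , λ n 6≤n → subst₂ (λ N p → ι p ℚ.< (N ℚ.- ι n) ℚ.÷ (+ 2 ℚ./ 1)) (ι-* n n) (sym (σ𝕀≗Φ n))
      (ι<÷2 (n * n) n (Φ n) (2Φ+n<n² n 6≤n)))
  where
  order : ∀ {a b x y} → ι a ≡ x → ι b ≡ y → a ≤ b → x ℚ.≤ y
  order refl refl = ι-mono-≤
  order′ : ∀ {a b x} → ι a ≡ x → b ≤ a → ι b ℚ.≤ ι 1 ℚ.* x
  order′ {a} {b} refl b≤a = subst (ι b ℚ.≤_) (sym (ℚ.*-identityˡ (ι a))) (ι-mono-≤ b≤a)
  n²≤10σ : ∀ n .{{_ : NonZero n}} → 1000000 ≤ n → n * n ≤ 10 * σ 𝕀 n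
  n²≤10σ n M≤n = subst (λ p → n * n ≤ 10 * p) (sym (σ𝕀≗Φ n))
    (≤-trans (m≤n*m (n * n) 3) (<⇒≤ (3n²<10Φ n M≤n)))
  σ≤n² : ∀ n .{{_ : NonZero n}} → 6 ≤ n → σ 𝕀 n ≤ n * n
  σ≤n² n 6≤n = subst (_≤ n * n) (sym (σ𝕀≗Φ n))
    (≤-trans (≤-trans (m≤n*m (Φ n) 2) (m≤m+n (2 * Φ n) n)) (<⇒≤ (2Φ+n<n² n 6≤n)))
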